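{- Let $\mathcal{G}=(H,\sigma,\alpha,h_0)$ be a rooted combinatorial map with underlying graph $G=(V,E)$. For each spanning tree $T$ of $G$, let $[T^-,T^+]$ denote the set of edge subsets $S\subseteq E$ obtained from $T$ by removing some (possibly none) internal $(\mathcal{G},T)$-active edges and adding some (possibly none) external $(\mathcal{G},T)$-active edges. Then the sets $[T^-,T^+]$, as $T$ ranges over the spanning trees of $G$, are pairwise disjoint and their union is the set $2^E$ of all subsets of $E$: $$2^E=\biguplus_{T\text{ spanning tree}}[T^-,T^+].$$
   Context: A rooted combinatorial map is $\mathcal{G}=(H,\sigma,\alpha,h_0)$ where $H$ is a finite set of half-edges, $\sigma$ is a permutation of $H$, $\alpha$ is a fixed-point-free involution of $H$, the group generated by $\sigma,\alpha$ acts transitively on $H$, and $h_0\in H$ is the root. Its underlying graph $G=(V,E)$ has the cycles of $\sigma$ as vertices and the pairs $\{h,\alpha(h)\}$ as edges; a half-edge is incident to the vertex (cycle of $\sigma$) containing it, and the endpoints of an edge are the vertices incident to its two half-edges ($G$ is connected; loops and multiple edges allowed). Subgraphs are spanning and identified with their edge sets. For a spanning tree $T$, edges in $T$ are internal, the others external. The motion function is $t(h)=\sigma\alpha(h)$ if the edge containing $h$ is internal and $t(h)=\sigma(h)$ otherwise; it is a cyclic permutation of $H$. The $(\mathcal{G},T)$-order on $H$ is $h_0<t(h_0)<t^2(h_0)<\dots<t^{|H|-1}(h_0)$, and edges are ordered by $\{h_1,h_2\}<\{h_1',h_2'\}$ iff $\min(h_1,h_2)<\min(h_1',h_2')$. The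 fundamental cycle of an external edge $e$ is the set of edges $e'$ such that $T-e'+e$ is a spanning tree; the fundamental cocycle of an internal edge $e$ is the set of edges $e'$ such that $T-e+e'$ is a spanning tree. An external (resp. internal) edge is $(\mathcal{G},T)$-active if it is minimal for the $(\mathcal{G},T)$-order in its fundamental cycle (resp. cocycle). -}

module Defs where

open import Data.Nat using (ℕ; zero; suc; _<_)
open import Data.Fin using (Fin; zero; suc; inject₁; fromℕ; _≟_)
open import Data.Fin.Permutation using (Permutation′; _⟨$⟩ʳ_; _⟨$⟩ˡ_)
open import Data.Bool using (Bool; true; false; _∧_; _∨_; not; if_then_else_)
open import Data.Product using (Σ; ∃; _×_; _,_)
open import Data.Sum using (_⊎_)
open import Relation.Binary.PropositionalEquality using (_≡_; _≢_)
open import Relation.Binary.Construct.Closure.ReflexiveTransitive using (Star)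
open import Relation.Nullary using (¬_)
open import Relation.Nullary.Decidable using (⌊_⌋)

iter : {A : Set} → (A → A) → ℕ → A → A
iter f zero    x = x
iter f (suc k) x = f (iter f k x)

record RootedMap : Set where
  field
    n         : ℕ
    σ         : Permutation′ n
    α         : Permutation′ n
    α-invol   : ∀ h → α ⟨$⟩ʳ (α ⟨$⟩ʳ h) ≡ h
    α-fpf     : ∀ h → α ⟨$⟩ʳ h ≢ h
    -- generator steps of the group ⟨σ, α⟩ (α is its own inverse)
  GenStep : Fin n → Fin n → Set
  GenStep h h' = (h' ≡ σ ⟨$⟩ʳ h) ⊎ (h' ≡ σ ⟨$⟩ˡ h) ⊎ (h' ≡ α ⟨$⟩ʳ h)
  field
    transitive : ∀ h h' → Star GenStep h h'
    root       : Fin n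

module _ (M : RootedMap) where
  open RootedMap M

  H : Set
  H = Fin n

  σ′ α′ : H → H
  σ′ h = σ ⟨$⟩ʳ h
  α′ h = α ⟨$⟩ʳ h

  SameVertex : H → H → Set
  SameVertex h h' = ∃ λ k → iter σ′ k h ≡ h'

  -- an edge subset is a Boolean predicate on half-edges invariant under α
  -- (an edge {h, α h} belongs to S iff S h ≡ true)
  AlphaInv : (H → Bool) → Set
  AlphaInv S = ∀ h → S (α′ h) ≡ S h

  inEdge : H → H → Bool
  inEdge h x = ⌊ x ≟ h ⌋ ∨ ⌊ x ≟ α′ h ⌋

  removeEdge addEdge : (H → Bool) → H → (H → Bool)
  removeEdge T h x = T x ∧ not (inEdge h x)
  addEdge    T h x = T x ∨ inEdge h x

  Step : (H → Bool) → H → H → Set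
  Step S h h' = (h' ≡ σ′ h) ⊎ (h' ≡ σ ⟨$⟩ˡ h) ⊎ (S h ≡ true × h' ≡ α′ h)

  Connected : (H → Bool) → Set
  Connected S = ∀ h h' → Star (Step S) h h'

  -- a (simple) cycle of length k+1 in S: half-edges c 0 … c k such that the
  -- edges {c i, α(c i)} are in S and pairwise distinct, edge i goes from the
  -- vertex of c i to the vertex of c (i+1) (cyclically), and the vertices of
  -- c 0 … c k are pairwise distinct.
  record Cycle (S : H → Bool) (k : ℕ) : Set where
    field
      c        : Fin (suc k) → H
      inS      : ∀ i → S (c i) ≡ true
      edgesDistinct : ∀ i j → i ≢ j → (c i ≢ c j) × (c i ≢ α′ (c j))
      links    : ∀ (i : Fin k) → SameVertex (α′ (c (inject₁ i))) (c (suc i))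
      closes   : SameVertex (α′ (c (fromℕ k))) (c zero)
      vertsDistinct : ∀ i j → i ≢ j → ¬ SameVertex (c i) (c j)

  Acyclic : (H → Bool) → Set
  Acyclic S = ∀ k → ¬ Cycle S k

  SpanningTree : (H → Bool) → Set
  SpanningTree T = AlphaInv T × Connected T × Acyclic T

  motion : (H → Bool) → H → H
  motion T h = if T h then σ′ (α′ h) else σ′ h

  InFundCycle : (H → Bool) → H → H → Set
  InFundCycle T h x = SpanningTree (addEdge (removeEdge T x) h)

  InFundCocycle : (H → Bool) → H → H → Set
  InFundCocycle T h x = SpanningTree (addEdge (removeEdge T h) x)

  -- the edge of h is minimal, for the (G,T)-order, in the edge set C:
  -- the first half-edge (in the order h0 < t h0 < t² h0 < …) belonging to an
  -- edge of C belongs to the edge of h.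
  MinimalIn : (H → Bool) → (H → Set) → H → Set
  MinimalIn T C h =
    Σ ℕ λ k → k < n × inEdge h (iter (motion T) k root) ≡ true
      × (∀ j → j < k → ¬ C (iter (motion T) j root))

  ExternalActive : (H → Bool) → H → Set
  ExternalActive T h = T h ≡ false × MinimalIn T (InFundCycle T h) h

  InternalActive : (H → Bool) → H → Set
  InternalActive T h = T h ≡ true × MinimalIn T (InFundCocycle T h) h

  InInterval : (H → Bool) → (H → Bool) → Set
  InInterval T S =
    AlphaInv S ×
    (∀ h → T h ≡ true → S h ≡ false → InternalActive T h) ×
    (∀ h → T h ≡ false → S h ≡ true → ExternalActive T h)

{-# OPTIONS --safe #-}
module Submission where

-- For a spanning tree T, read the tour h₀, t h₀, t² h₀, … as a chord diagram with one chord per edge.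
-- Deleting f ∈ T leaves each of the two arcs cut out by the chord of f inside one component, so a chord
-- exchangeable with f must cross it.  For crossing chords, comparing first endpoints is the same as
-- comparing last endpoints; hence e is active iff every other edge of its fundamental (co)cycle is met
-- before e when the tour is run backwards.  The backward tour up to e only depends on T at the edges
-- already met, so trees can be compared, and modified, one backward step at a time:
--   * if S lies in the intervals of T and T′, take the first edge in backward order where they differ;
--     S differs there from T or from T′, so the edge is active for that tree, while basis exchange
--     yields an edge of T′ ∖ T or T ∖ T′ in its fundamental (co)cycle, which was met before: absurd;
--   * for existence, whenever T differs from S at the current edge and this edge is not active,
--     exchange it with an edge not met so far; basis exchange shows that earlier activities survive.

open import Defs
open import Data.Bool using (Bool; true; false; not; if_then_else_)
open import Data.Bool.Properties using (¬-not) renaming (_≟_ to _≟ᵇ_)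
open import Data.Empty using (⊥; ⊥-elim)
open import Data.Fin using (Fin; zero; suc; toℕ; fromℕ; fromℕ<; inject₁; _≟_)
open import Data.Fin.Permutation using (_⟨$⟩ˡ_; inverseˡ; inverseʳ)
open import Data.Fin.Properties using (pigeonhole; injective⇒≤; any?; toℕ<n; toℕ-fromℕ<)
open import Data.List using (List; []; _∷_; length; lookup; allFin)
open import Data.List.Membership.Propositional using () renaming (_∈_ to _∈ˡ_)
open import Data.List.Membership.Propositional.Properties using (∈-allFin; ∈-lookup)
open import Data.List.Relation.Unary.All as All using (All; []; _∷_)
open import Data.List.Relation.Unary.Any as Any using (Any; here; there)
open import Data.List.Relation.Unary.AllPairs using (AllPairs; []; _∷_)
open import Data.Nat using (ℕ; zero; suc; _+_; _∸_; _≤_; _<_; z≤n; s≤s; s≤s⁻¹; _<?_; _≤?_)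
open import Data.Nat.Properties using (≤-refl; ≤-trans; ≤-antisym; <-trans; <-≤-trans; ≤-<-trans; <⇒≤; <-irrefl; ≤∧≢⇒<; ≰⇒>; ≮⇒≥; m≤n⇒m<n∨m≡n; m≤n+m; m∸n+n≡m; m∸n≤m; m<n⇒0<n∸m; m+[n∸m]≡n; +-suc; +-identityʳ; <-cmp; n<1+n)
open import Data.Product using (Σ; ∃; _×_; _,_; proj₁; proj₂)
open import Data.Sum using (_⊎_; inj₁; inj₂)
open import Function using (_∘_)
open import Relation.Binary.Construct.Closure.ReflexiveTransitive using (Star; ε; _◅_; _◅◅_; reverse; kleisliStar)
open import Relation.Binary.Definitions using (tri<; tri≈; tri>)
open import Relation.Binary.PropositionalEquality using (_≡_; _≢_; refl; sym; trans; cong; subst; module ≡-Reasoning)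
open import Relation.Nullary using (¬_; Dec; yes; no; contradiction)
open import Relation.Nullary.Decidable using (map′; _×-dec_; _⊎-dec_; ¬?; decidable-stable)

clash : ∀ {b} → b ≡ true → b ≡ false → ⊥
clash refl ()

-- Iteration of a map and orbits of an injection on a finite set.

iter-+ : ∀ {A : Set} (f : A → A) j k x → iter f (j + k) x ≡ iter f j (iter f k x)
iter-+ f zero    k x = refl
iter-+ f (suc j) k x = cong f (iter-+ f j k x)

iter-suc : ∀ {A : Set} (f : A → A) k x → iter f k (f x) ≡ f (iter f k x)
iter-suc f zero    x = refl
iter-suc f (suc k) x = cong f (iter-suc f k x)

iter-reduce : ∀ {A : Set} (f : A → A) {p x} → iter f (suc p) x ≡ x →
  ∀ k → Σ ℕ λ j → j < suc p × iter f j x ≡ iter f k x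
iter-reduce f per zero = 0 , s≤s z≤n , refl
iter-reduce f {p} per (suc k) with iter-reduce f per k
... | j , s≤s j≤p , eq with m≤n⇒m<n∨m≡n j≤p
...   | inj₁ j<p  = suc j , s≤s j<p , cong f eq
...   | inj₂ refl = 0 , s≤s z≤n , trans (sym per) (cong f eq)

module _ {m : ℕ} (f : Fin m → Fin m) (f-inj : ∀ {x y} → f x ≡ f y → x ≡ y) where

  iter-injective : ∀ k {x y} → iter f k x ≡ iter f k y → x ≡ y
  iter-injective zero    eq = eq
  iter-injective (suc k) eq = iter-injective k (f-inj eq)

  iter-cancel : ∀ {i j x} → i < j → iter f i x ≡ iter f j x →
    Σ ℕ λ d → suc d ≤ j × iter f (suc d) x ≡ x
  iter-cancel {i} {j} {x} i<j eq with j ∸ i | m<n⇒0<n∸m i<j | m+[n∸m]≡n (<⇒≤ i<j) | m∸n≤m j i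
  ... | suc d | _ | i+d≡j | d≤j = d , d≤j ,
    sym (iter-injective i (trans eq (trans (cong (λ k → iter f k x) (sym i+d≡j)) (iter-+ f i (suc d) x))))

  period : ∀ x → Σ ℕ λ p → p < m × iter f (suc p) x ≡ x
  period x with pigeonhole (n<1+n m) (λ i → iter f (toℕ i) x)
  ... | i , j , i<j , eq with iter-cancel i<j eq
  ...   | d , d<j , per = d , ≤-trans d<j (s≤s⁻¹ (toℕ<n j)) , per

  orbit-sym : ∀ k {x y} → iter f k x ≡ y → Σ ℕ λ j → iter f j y ≡ x
  orbit-sym zero    eq = 0 , sym eq
  orbit-sym (suc k) {x} {y} eq with orbit-sym k {x} refl | period (iter f k x)
  -- The k-th iterate has period `suc p`, so `p` steps from its successor `y` lead back to it;
  -- `back` does the rest.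
  ... | j , back | p , _ , per = j + p , (begin
      iter f (j + p) y                        ≡⟨ iter-+ f j p y ⟩
      iter f j (iter f p y)                   ≡⟨ cong (iter f j ∘ iter f p) (sym eq) ⟩
      iter f j (iter f p (f (iter f k x)))    ≡⟨ cong (iter f j) (trans (iter-suc f p _) per) ⟩
      iter f j (iter f k x)                   ≡⟨ back ⟩
      x                                       ∎)
    where open ≡-Reasoning

  orbit? : ∀ x y → Dec (Σ ℕ λ k → iter f k x ≡ y)
  orbit? x y = map′ (λ (i , eq) → toℕ i , eq) bounded (any? λ i → iter f (toℕ i) x ≟ y)
    where
      bounded : (Σ ℕ λ k → iter f k x ≡ y) → ∃ λ (i : Fin m) → iter f (toℕ i) x ≡ y
      bounded (k , eq) with period x
      ... | p , p<m , per with iter-reduce f per k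
      ...   | j , j≤p , eq′ = fromℕ< j<m ,
              trans (cong (λ i → iter f i x) (toℕ-fromℕ< j<m)) (trans eq′ eq)
        where j<m = <-≤-trans j≤p p<m

module _ (M : RootedMap) where
  open RootedMap M using (n; σ; α-invol; α-fpf; transitive; root)

  -- Half-edges, edges and edge sets.

  HalfEdge : Set
  HalfEdge = Fin n

  EdgeSet : Set
  EdgeSet = HalfEdge → Bool

  opp rot rot⁻¹ : HalfEdge → HalfEdge
  opp   = α′ M
  rot   = σ′ M
  rot⁻¹ = σ ⟨$⟩ˡ_

  rot-injective : ∀ {x y} → rot x ≡ rot y → x ≡ y
  rot-injective eq = trans (sym (inverseˡ σ)) (trans (cong rot⁻¹ eq) (inverseˡ σ))

  opp-injective : ∀ {x y} → opp x ≡ opp y → x ≡ y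
  opp-injective {x} {y} eq = trans (sym (α-invol x)) (trans (cong opp eq) (α-invol y))

  Edge : HalfEdge → HalfEdge → Set
  Edge h x = x ≡ h ⊎ x ≡ opp h

  edge? : ∀ h x → Dec (Edge h x)
  edge? h x = (x ≟ h) ⊎-dec (x ≟ opp h)

  edge-sym : ∀ {h x} → Edge h x → Edge x h
  edge-sym (inj₁ refl) = inj₁ refl
  edge-sym (inj₂ refl) = inj₂ (sym (α-invol _))

  edge-opp : ∀ {h x} → Edge h x → Edge h (opp x)
  edge-opp (inj₁ refl) = inj₂ refl
  edge-opp (inj₂ refl) = inj₁ (α-invol _)

  edge-trans : ∀ {h x y} → Edge h x → Edge x y → Edge h y
  edge-trans e (inj₁ refl) = e
  edge-trans e (inj₂ refl) = edge-opp e

  inEdge-true : ∀ {h x} → Edge h x → inEdge M h x ≡ true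
  inEdge-true {h} {x} e with x ≟ h | x ≟ opp h
  ... | yes _  | _      = refl
  ... | no _   | yes _  = refl
  ... | no x≢h | no x≢h′ with e
  ...   | inj₁ eq = contradiction eq x≢h
  ...   | inj₂ eq = contradiction eq x≢h′

  inEdge-false : ∀ {h x} → ¬ Edge h x → inEdge M h x ≡ false
  inEdge-false {h} {x} ¬e with x ≟ h | x ≟ opp h
  ... | yes eq | _      = contradiction (inj₁ eq) ¬e
  ... | no _   | yes eq = contradiction (inj₂ eq) ¬e
  ... | no _   | no _   = refl

  edge-inEdge : ∀ {h x} → inEdge M h x ≡ true → Edge h x
  edge-inEdge {h} {x} eq with edge? h x
  ... | yes e = e
  ... | no ¬e = ⊥-elim (clash eq (inEdge-false ¬e))

  infix 4 _∈_ _∉_ _⊆_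
  infixl 6 _∖_ _⊕_

  _∈_ _∉_ : HalfEdge → EdgeSet → Set
  x ∈ S = S x ≡ true
  x ∉ S = S x ≡ false

  _⊆_ : EdgeSet → EdgeSet → Set
  S ⊆ S′ = ∀ x → x ∈ S → x ∈ S′

  member : ∀ S x → x ∈ S ⊎ x ∉ S
  member S x with S x
  ... | true  = inj₁ refl
  ... | false = inj₂ refl

  notMember : ∀ {S x} → ¬ x ∈ S → x ∉ S
  notMember {S} {x} ¬x∈S with member S x
  ... | inj₁ x∈S = contradiction x∈S ¬x∈S
  ... | inj₂ x∉S = x∉S

  inv-edge : ∀ {S h x} → AlphaInv M S → Edge h x → S x ≡ S h
  inv-edge inv (inj₁ refl) = refl
  inv-edge inv (inj₂ refl) = inv _

  inEdge-opp : ∀ h x → inEdge M h (opp x) ≡ inEdge M h x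
  inEdge-opp h x with edge? h x
  ... | yes e = trans (inEdge-true (edge-opp e)) (sym (inEdge-true e))
  ... | no ¬e = trans (inEdge-false λ e → ¬e (subst (Edge h) (α-invol x) (edge-opp e))) (sym (inEdge-false ¬e))

  -- Opaque so that the arguments of S ∖ h and S ⊕ h can be inferred from them.
  opaque
    _∖_ _⊕_ : EdgeSet → HalfEdge → EdgeSet
    _∖_ = removeEdge M
    _⊕_ = addEdge M

    ∈-∖⁺ : ∀ {S h x} → x ∈ S → ¬ Edge h x → x ∈ S ∖ h
    ∈-∖⁺ x∈S ¬e rewrite x∈S | inEdge-false ¬e = refl

    ∈-∖⁻ : ∀ {S h x} → x ∈ S ∖ h → x ∈ S × ¬ Edge h x
    ∈-∖⁻ {S} {h} {x} p with S x | inEdge M h x in eq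
    ... | true | false = refl , λ e → clash (inEdge-true e) eq

    ∈-⊕ˡ : ∀ {S h x} → x ∈ S → x ∈ S ⊕ h
    ∈-⊕ˡ x∈S rewrite x∈S = refl

    ∈-⊕ʳ : ∀ {S h x} → Edge h x → x ∈ S ⊕ h
    ∈-⊕ʳ {S} {h} {x} e with S x
    ... | true  = refl
    ... | false = inEdge-true e

    ∈-⊕⁻ : ∀ {S h x} → x ∈ S ⊕ h → x ∈ S ⊎ Edge h x
    ∈-⊕⁻ {S} {h} {x} p with S x
    ... | true  = inj₁ refl
    ... | false = inj₂ (edge-inEdge p)

    inv-∖ : ∀ {S} h → AlphaInv M S → AlphaInv M (S ∖ h)
    inv-∖ h inv x rewrite inv x | inEdge-opp h x = refl

    inv-⊕ : ∀ {S} h → AlphaInv M S → AlphaInv M (S ⊕ h)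
    inv-⊕ h inv x rewrite inv x | inEdge-opp h x = refl

  ⊆∖⊕ : ∀ {S} h → S ⊆ S ∖ h ⊕ h
  ⊆∖⊕ h x x∈S with edge? h x
  ... | yes e = ∈-⊕ʳ e
  ... | no ¬e = ∈-⊕ˡ (∈-∖⁺ x∈S ¬e)

  -- Connectivity within an edge set.

  Conn : EdgeSet → HalfEdge → HalfEdge → Set
  Conn S = Star (Step M S)

  conn-rot : ∀ {S} x → Conn S x (rot x)
  conn-rot x = inj₁ refl ◅ ε

  conn-opp : ∀ {S x} → x ∈ S → Conn S x (opp x)
  conn-opp x∈S = inj₂ (inj₂ (x∈S , refl)) ◅ ε

  conn-bind : ∀ {S S′} → (∀ x → x ∈ S → Conn S′ x (opp x)) → ∀ {x y} → Conn S x y → Conn S′ x y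
  conn-bind {S} {S′} f = kleisliStar (λ x → x) step
    where
      step : ∀ {x y} → Step M S x y → Conn S′ x y
      step (inj₁ eq)                = inj₁ eq ◅ ε
      step (inj₂ (inj₁ eq))         = inj₂ (inj₁ eq) ◅ ε
      step (inj₂ (inj₂ (x∈S , refl))) = f _ x∈S

  conn-mono : ∀ {S S′} → S ⊆ S′ → ∀ {x y} → Conn S x y → Conn S′ x y
  conn-mono S⊆S′ = conn-bind λ x x∈S → conn-opp (S⊆S′ x x∈S)

  conn-sym : ∀ {S} → AlphaInv M S → ∀ {x y} → Conn S x y → Conn S y x
  conn-sym {S} inv = reverse step
    where
      step : ∀ {x y} → Step M S x y → Step M S y x
      step (inj₁ refl)                  = inj₂ (inj₁ (sym (inverseˡ σ)))
      step (inj₂ (inj₁ refl))           = inj₁ (sym (inverseʳ σ))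
      step (inj₂ (inj₂ (x∈S , refl)))   = inj₂ (inj₂ (trans (inv _) x∈S , sym (α-invol _)))

  conn-iter : ∀ {S} k x → Conn S x (iter rot k x)
  conn-iter zero    x = ε
  conn-iter (suc k) x = conn-iter k x ◅◅ conn-rot _

  ConnVia : EdgeSet → HalfEdge → HalfEdge → HalfEdge → Set
  ConnVia S z x y = (Conn S x z × Conn S (opp z) y) ⊎ (Conn S x (opp z) × Conn S z y)

  -- One crossing of `z` suffices: what follows a later crossing starts at `z` or `opp z`, and a
  -- path about to cross is at one of these ends, hence there already or one crossing away.
  conn-⊕ : ∀ {S z x y} → Conn (S ⊕ z) x y → Conn S x y ⊎ ConnVia S z x y
  conn-⊕ ε = inj₁ ε
  conn-⊕ {S} {z} (s ◅ ss) = go s (conn-⊕ {S} {z} ss)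
    where
      prepend : ∀ {x x′ y} → Conn S x x′ → Conn S x′ y ⊎ ConnVia S z x′ y → Conn S x y ⊎ ConnVia S z x y
      prepend c (inj₁ d)               = inj₁ (c ◅◅ d)
      prepend c (inj₂ (inj₁ (d , d′))) = inj₂ (inj₁ (c ◅◅ d , d′))
      prepend c (inj₂ (inj₂ (d , d′))) = inj₂ (inj₂ (c ◅◅ d , d′))
      from-z : ∀ {y} → Conn S (opp z) y ⊎ ConnVia S z (opp z) y → Conn S z y ⊎ ConnVia S z z y
      from-z (inj₁ d)               = inj₂ (inj₁ (ε , d))
      from-z (inj₂ (inj₁ (_ , d)))  = inj₂ (inj₁ (ε , d))
      from-z (inj₂ (inj₂ (_ , d)))  = inj₁ d
      from-opp : ∀ {y} → Conn S z y ⊎ ConnVia S z z y → Conn S (opp z) y ⊎ ConnVia S z (opp z) y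
      from-opp (inj₁ d)              = inj₂ (inj₂ (ε , d))
      from-opp (inj₂ (inj₁ (_ , d))) = inj₁ d
      from-opp (inj₂ (inj₂ (_ , d))) = inj₂ (inj₂ (ε , d))
      go : ∀ {x x′ y} → Step M (S ⊕ z) x x′ → Conn S x′ y ⊎ ConnVia S z x′ y → Conn S x y ⊎ ConnVia S z x y
      go (inj₁ eq)        r = prepend (inj₁ eq ◅ ε) r
      go (inj₂ (inj₁ eq)) r = prepend (inj₂ (inj₁ eq) ◅ ε) r
      go (inj₂ (inj₂ (x∈ , refl))) r with ∈-⊕⁻ x∈
      ... | inj₁ x∈S         = prepend (conn-opp x∈S) r
      ... | inj₂ (inj₁ refl) = from-z r
      ... | inj₂ (inj₂ refl) = from-opp (subst (λ v → Conn S v _ ⊎ ConnVia S z v _) (α-invol z) r)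

  conn-∖ : ∀ {S} z {x y} → Conn S x y → Conn (S ∖ z) x y ⊎ ConnVia (S ∖ z) z x y
  conn-∖ z c = conn-⊕ (conn-mono (⊆∖⊕ z) c)

  -- Decidability of connectivity.

  ∅ : EdgeSet
  ∅ _ = false

  sameVertex? : ∀ x y → Dec (SameVertex M x y)
  sameVertex? = orbit? rot rot-injective

  sv-refl : ∀ {x} → SameVertex M x x
  sv-refl = 0 , refl

  sv-sym : ∀ {x y} → SameVertex M x y → SameVertex M y x
  sv-sym (k , eq) = orbit-sym rot rot-injective k eq

  sv-trans : ∀ {x y z} → SameVertex M x y → SameVertex M y z → SameVertex M x z
  sv-trans {x} (j , refl) (k , refl) = k + j , iter-+ rot k j x

  sv-rot⁻¹ : ∀ {x} → SameVertex M x (rot⁻¹ x)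
  sv-rot⁻¹ = sv-sym (1 , inverseʳ σ)

  sv-conn : ∀ {S x y} → SameVertex M x y → Conn S x y
  sv-conn (k , refl) = conn-iter k _

  conn-∅ : ∀ {x y} → Conn ∅ x y → SameVertex M x y
  conn-∅ ε = sv-refl
  conn-∅ (inj₁ refl ◅ ss)        = sv-trans (1 , refl) (conn-∅ ss)
  conn-∅ (inj₂ (inj₁ refl) ◅ ss) = sv-trans sv-rot⁻¹ (conn-∅ ss)

  conn-⊕? : ∀ {S} → (∀ x y → Dec (Conn S x y)) → AlphaInv M S → ∀ z x y → Dec (Conn (S ⊕ z) x y)
  conn-⊕? {S} c? inv z x y = map′ join conn-⊕
    (c? x y ⊎-dec ((c? x z ×-dec c? (opp z) y) ⊎-dec (c? x (opp z) ×-dec c? z y)))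
    where
      up : ∀ {x y} → Conn S x y → Conn (S ⊕ z) x y
      up = conn-mono λ x → ∈-⊕ˡ
      bridge : Conn (S ⊕ z) z (opp z)
      bridge = conn-opp (∈-⊕ʳ {S} (inj₁ refl))
      join : Conn S x y ⊎ ConnVia S z x y → Conn (S ⊕ z) x y
      join (inj₁ c)               = up c
      join (inj₂ (inj₁ (c , d)))  = up c ◅◅ bridge ◅◅ up d
      join (inj₂ (inj₂ (c , d)))  = up c ◅◅ conn-sym (inv-⊕ z inv) bridge ◅◅ up d

  -- Rebuilds `S` edge by edge, so that connectivity is decided by induction on the list: without
  -- edges it means lying on one vertex, and `conn-⊕?` handles each added edge.
  restrict : EdgeSet → List HalfEdge → EdgeSet
  restrict S []      = ∅
  restrict S (h ∷ l) = if S h then restrict S l ⊕ h else restrict S l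

  restrict-inv : ∀ S l → AlphaInv M (restrict S l)
  restrict-inv S []      x = refl
  restrict-inv S (h ∷ l) with S h
  ... | true  = inv-⊕ h (restrict-inv S l)
  ... | false = restrict-inv S l

  restrict-conn? : ∀ S l x y → Dec (Conn (restrict S l) x y)
  restrict-conn? S [] x y = map′ sv-conn conn-∅ (sameVertex? x y)
  restrict-conn? S (h ∷ l) with S h
  ... | true  = conn-⊕? (restrict-conn? S l) (restrict-inv S l) h
  ... | false = restrict-conn? S l

  restrict-⊆ : ∀ {S} → AlphaInv M S → ∀ l → restrict S l ⊆ S
  restrict-⊆ {S} inv (h ∷ l) x x∈ with member S h
  ... | inj₂ h∉S rewrite h∉S = restrict-⊆ inv l x x∈
  ... | inj₁ h∈S with ∈-⊕⁻ (subst (λ b → (if b then restrict S l ⊕ h else restrict S l) x ≡ true) h∈S x∈)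
  ...   | inj₁ x∈l = restrict-⊆ inv l x x∈l
  ...   | inj₂ e   = trans (inv-edge inv e) h∈S

  ⊆-restrict : ∀ {S l x} → x ∈ˡ l → x ∈ S → x ∈ restrict S l
  ⊆-restrict {S} {h ∷ l} (here refl) x∈S rewrite x∈S = ∈-⊕ʳ (inj₁ refl)
  ⊆-restrict {S} {h ∷ l} (there x∈l) x∈S with S h
  ... | true  = ∈-⊕ˡ (⊆-restrict {S} x∈l x∈S)
  ... | false = ⊆-restrict {S} x∈l x∈S

  conn? : ∀ {S} → AlphaInv M S → ∀ x y → Dec (Conn S x y)
  conn? {S} inv x y = map′ (conn-mono (restrict-⊆ inv (allFin n))) (conn-mono λ z → ⊆-restrict {S} (∈-allFin z))
    (restrict-conn? S (allFin n) x y)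

  -- Forests, spanning trees and basis exchange.

  -- Acyclicity in its working form, every edge being a bridge; `acyclic-forest` and
  -- `forest-acyclic` relate it to cycles.
  Forest : EdgeSet → Set
  Forest S = ∀ g → g ∈ S → ¬ Conn (S ∖ g) g (opp g)

  forest-⊆ : ∀ {S S′} → S ⊆ S′ → Forest S′ → Forest S
  forest-⊆ S⊆S′ forest g g∈S c = forest g (S⊆S′ g g∈S) (conn-mono sub c)
    where sub = λ x x∈ → let x∈S , ¬e = ∈-∖⁻ x∈ in ∈-∖⁺ (S⊆S′ x x∈S) ¬e

  not-conn-edge : ∀ {S} → AlphaInv M S → ∀ {z g} → Edge z g → ¬ Conn S z (opp z) → ¬ Conn S g (opp g)
  not-conn-edge inv (inj₁ refl) ¬c = ¬c
  not-conn-edge inv {z} (inj₂ refl) ¬c c = ¬c (conn-sym inv (subst (Conn _ _) (α-invol z) c))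

  -- A detour around an old edge `g` either avoids `z`, which `S` forbids, or crosses it once; then
  -- the rest of the detour together with `g` joins the ends of `z` inside `S`.
  forest-⊕ : ∀ {S z} → AlphaInv M S → Forest S → ¬ Conn S z (opp z) → Forest (S ⊕ z)
  forest-⊕ {S} {z} inv forest ¬c g g∈ c with edge? z g
  ... | yes e = not-conn-edge inv e ¬c (conn-mono sub c)
    where
      sub : S ⊕ z ∖ g ⊆ S
      sub x x∈ with ∈-∖⁻ x∈
      ... | x∈⊕ , ¬e with ∈-⊕⁻ x∈⊕
      ...   | inj₁ x∈S = x∈S
      ...   | inj₂ e′  = contradiction (edge-trans (edge-sym e) e′) ¬e
  ... | no ¬e with ∈-⊕⁻ g∈
  ...   | inj₂ e   = contradiction e ¬e
  ...   | inj₁ g∈S with conn-⊕ {S ∖ g} {z} (conn-mono sub c)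
    where
      sub : S ⊕ z ∖ g ⊆ S ∖ g ⊕ z
      sub x x∈ with ∈-∖⁻ x∈
      ... | x∈⊕ , ¬e′ with ∈-⊕⁻ x∈⊕
      ...   | inj₁ x∈S = ∈-⊕ˡ (∈-∖⁺ x∈S ¬e′)
      ...   | inj₂ e   = ∈-⊕ʳ e
  ...     | inj₁ d = forest g g∈S d
  ...     | inj₂ (inj₁ (d , d′)) = ¬c (conn-sym inv (up d) ◅◅ conn-opp g∈S ◅◅ conn-sym inv (up d′))
    where
      up : ∀ {x y} → Conn (S ∖ g) x y → Conn S x y
      up = conn-mono λ x x∈ → proj₁ (∈-∖⁻ x∈)
  ...     | inj₂ (inj₂ (d , d′)) = ¬c (up d′ ◅◅ conn-sym inv (conn-opp g∈S) ◅◅ up d)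
    where
      up : ∀ {x y} → Conn (S ∖ g) x y → Conn S x y
      up = conn-mono λ x x∈ → proj₁ (∈-∖⁻ x∈)

  record Tree (T : EdgeSet) : Set where
    constructor mkTree
    field
      inv    : AlphaInv M T
      conn   : Connected M T
      forest : Forest T
  open Tree

  Exch : EdgeSet → HalfEdge → HalfEdge → Set
  Exch T f e = Tree (T ∖ f ⊕ e)

  -- The path of `T` between the ends of `e` must cross `f`; with `e` it forms a detour around `f`,
  -- so no connection is lost.
  exch : ∀ {T f e} → Tree T → ¬ Conn (T ∖ f) e (opp e) → Exch T f e
  exch {T} {f} {e} tree ¬c = mkTree inv′ (λ x y → conn-bind step (conn tree x y))
    (forest-⊕ (inv-∖ f (inv tree)) (forest-⊆ (λ x x∈ → proj₁ (∈-∖⁻ x∈)) (forest tree)) ¬c)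
    where
      inv′ = inv-⊕ e (inv-∖ f (inv tree))
      sy : ∀ {x y} → Conn (T ∖ f ⊕ e) x y → Conn (T ∖ f ⊕ e) y x
      sy = conn-sym inv′
      up : ∀ {x y} → Conn (T ∖ f) x y → Conn (T ∖ f ⊕ e) x y
      up = conn-mono λ x → ∈-⊕ˡ
      bridge : Conn (T ∖ f ⊕ e) e (opp e)
      bridge = conn-opp (∈-⊕ʳ (inj₁ refl))
      detour : Conn (T ∖ f ⊕ e) f (opp f)
      detour with conn-∖ f (conn tree e (opp e))
      ... | inj₁ c              = contradiction c ¬c
      ... | inj₂ (inj₁ (c , d)) = sy (up c) ◅◅ bridge ◅◅ sy (up d)
      ... | inj₂ (inj₂ (c , d)) = up d ◅◅ sy bridge ◅◅ up c
      step : ∀ x → x ∈ T → Conn (T ∖ f ⊕ e) x (opp x)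
      step x x∈T with edge? f x
      ... | no ¬e = up (conn-opp (∈-∖⁺ x∈T ¬e))
      ... | yes (inj₁ refl) = detour
      ... | yes (inj₂ refl) = subst (Conn _ _) (sym (α-invol f)) (sy detour)

  exch-cut : ∀ {T f e} → AlphaInv M T → Exch T f e → e ∉ T → ¬ Conn (T ∖ f) e (opp e)
  exch-cut {T} {f} {e} T-inv tree e∉T c = forest tree e (∈-⊕ʳ (inj₁ refl)) (conn-mono sub c)
    where
      sub : T ∖ f ⊆ T ∖ f ⊕ e ∖ e
      sub x x∈ = ∈-∖⁺ (∈-⊕ˡ x∈) λ ed → clash (proj₁ (∈-∖⁻ x∈)) (trans (inv-edge T-inv ed) e∉T)

  -- The path of `B` between the ends of `e` runs from one component of A - e to the other. `walk`
  -- follows it on the side of `e`; the first edge leaving that side is `f`.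
  exchange-out : ∀ {A B e} → Tree A → Tree B → e ∈ A → e ∉ B →
    Σ HalfEdge λ f → f ∈ B × f ∉ A × Exch A e f
  exchange-out {A} {B} {e} treeA treeB e∈A e∉B = walk ε (conn treeB e (opp e))
    where
      A′ = A ∖ e
      inv′ = inv-∖ e (inv treeA)
      cut : ¬ Conn A′ e (opp e)
      cut = forest treeA e e∈A
      side : ∀ z → Conn A′ e z ⊎ Conn A′ (opp e) z
      side z with conn-∖ e (conn treeA e z)
      ... | inj₁ c              = inj₁ c
      ... | inj₂ (inj₁ (_ , c)) = inj₂ c
      ... | inj₂ (inj₂ (c , _)) = contradiction c cut
      walk : ∀ {z} → Conn A′ e z → Conn B z (opp e) → Σ HalfEdge λ f → f ∈ B × f ∉ A × Exch A e f
      walk c ε = contradiction c cut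
      walk c (inj₁ refl ◅ ss) = walk (c ◅◅ conn-rot _) ss
      walk c (inj₂ (inj₁ eq) ◅ ss) = walk (c ◅◅ inj₂ (inj₁ eq) ◅ ε) ss
      walk {z} c (inj₂ (inj₂ (z∈B , refl)) ◅ ss) with side (opp z)
      ... | inj₁ d = walk d ss
      ... | inj₂ d = z , z∈B , notMember {A} (λ z∈A → ¬c′ (conn-opp (∈-∖⁺ z∈A ¬ed))) , exch treeA ¬c′
        where
          ¬c′ : ¬ Conn A′ z (opp z)
          ¬c′ c′ = cut (c ◅◅ c′ ◅◅ conn-sym inv′ d)
          ¬ed : ¬ Edge e z
          ¬ed ed = clash z∈B (trans (inv-edge (inv treeB) ed) e∉B)

  -- If no edge of B - A separates the ends of `e` when removed from `B`, all of them can be removed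
  -- in turn: a path forced through `f` would, with a path in B - f between the ends of `e`, form a
  -- detour around `f`. What remains lies in A - e, where the ends of `e` are separated.
  exchange-in : ∀ {A B e} → Tree A → Tree B → e ∈ A → e ∉ B →
    Σ HalfEdge λ f → f ∈ B × f ∉ A × Exch B f e
  exchange-in {A} {B} {e} treeA treeB e∈A e∉B
    with any? (λ f → (B f ≟ᵇ true) ×-dec (A f ≟ᵇ false) ×-dec ¬? (conn? (inv-∖ f (inv treeB)) e (opp e)))
  ... | yes (f , f∈B , f∉A , ¬c) = f , f∈B , f∉A , exch treeB ¬c
  ... | no none = ⊥-elim (forest treeA e e∈A (conn-mono sub (thin-conn (allFin n))))
    where
      avoid : ∀ f → f ∈ B → f ∉ A → Conn (B ∖ f) e (opp e)
      avoid f f∈B f∉A = decidable-stable (conn? (inv-∖ f (inv treeB)) e (opp e)) λ ¬c → none (f , f∈B , f∉A , ¬c)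
      thin : List HalfEdge → EdgeSet
      thin []      = B
      thin (f ∷ l) = if A f then thin l else thin l ∖ f
      thin-⊆ : ∀ l → thin l ⊆ B
      thin-⊆ []      x x∈ = x∈
      thin-⊆ (f ∷ l) x x∈ with A f
      ... | true  = thin-⊆ l x x∈
      ... | false = thin-⊆ l x (proj₁ (∈-∖⁻ x∈))
      thin-conn : ∀ l → Conn (thin l) e (opp e)
      thin-conn [] = conn treeB e (opp e)
      thin-conn (f ∷ l) with A f in f∉A
      ... | true  = thin-conn l
      ... | false with conn-∖ f (thin-conn l) | member B f
      ...   | inj₁ c | _ = c
      ...   | inj₂ _ | inj₂ f∉B = conn-mono sub′ (thin-conn l)
        where
          sub′ : thin l ⊆ thin l ∖ f
          sub′ x x∈ = ∈-∖⁺ x∈ λ ed → clash (thin-⊆ l x x∈) (trans (inv-edge (inv treeB) ed) f∉B)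
      ...   | inj₂ via | inj₁ f∈B = ⊥-elim (forest treeB f f∈B (loop via))
        where
          up : ∀ {x y} → Conn (thin l ∖ f) x y → Conn (B ∖ f) x y
          up = conn-mono λ x x∈ → let x∈l , ¬ed = ∈-∖⁻ x∈ in ∈-∖⁺ (thin-⊆ l x x∈l) ¬ed
          sy : ∀ {x y} → Conn (B ∖ f) x y → Conn (B ∖ f) y x
          sy = conn-sym (inv-∖ f (inv treeB))
          around : Conn (B ∖ f) e (opp e)
          around = avoid f f∈B f∉A
          loop : ConnVia (thin l ∖ f) f e (opp e) → Conn (B ∖ f) f (opp f)
          loop (inj₁ (c , d)) = sy (up c) ◅◅ around ◅◅ sy (up d)
          loop (inj₂ (c , d)) = up d ◅◅ sy around ◅◅ up c
      thin-avoids : ∀ {l x} → x ∈ˡ l → x ∈ thin l → x ∈ A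
      thin-avoids {f ∷ l} {x} (here refl) x∈ with A x
      ... | true  = refl
      ... | false = contradiction (inj₁ refl) (proj₂ (∈-∖⁻ x∈))
      thin-avoids {f ∷ l} (there x∈l) x∈ with A f
      ... | true  = thin-avoids x∈l x∈
      ... | false = thin-avoids x∈l (proj₁ (∈-∖⁻ x∈))
      sub : thin (allFin n) ⊆ A ∖ e
      sub x x∈ = ∈-∖⁺ (thin-avoids (∈-allFin x) x∈)
        λ ed → clash (thin-⊆ (allFin n) x x∈) (trans (inv-edge (inv treeB) ed) e∉B)

  spanningTree-exists : Σ EdgeSet Tree
  spanningTree-exists with grow (allFin n)
    where
      grow : ∀ l → Σ EdgeSet λ F → AlphaInv M F × Forest F × (∀ {x} → x ∈ˡ l → Conn F x (opp x))
      grow [] = ∅ , (λ _ → refl) , (λ _ ()) , λ ()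
      grow (h ∷ l) with grow l
      ... | F , F-inv , F-forest , spans with conn? F-inv h (opp h)
      ...   | yes c = F , F-inv , F-forest , λ { (here refl) → c ; (there x∈l) → spans x∈l }
      ...   | no ¬c = F ⊕ h , inv-⊕ h F-inv , forest-⊕ F-inv F-forest ¬c ,
              λ { (here refl) → conn-opp (∈-⊕ʳ (inj₁ refl)) ; (there x∈l) → conn-mono (λ x → ∈-⊕ˡ) (spans x∈l) }
  ... | F , F-inv , F-forest , spans = F , mkTree F-inv (λ x y → kleisliStar (λ z → z) step (transitive x y)) F-forest
    where
      step : ∀ {x y} → RootedMap.GenStep M x y → Conn F x y
      step (inj₁ eq)          = inj₁ eq ◅ ε
      step (inj₂ (inj₁ eq))   = inj₂ (inj₁ eq) ◅ ε
      step (inj₂ (inj₂ refl)) = spans (∈-allFin _)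

  -- Simple walks, and the equivalence of `Acyclic` and `Forest`.

  Fresh : HalfEdge → HalfEdge → Set
  Fresh a b = ¬ SameVertex M a b × a ≢ opp b

  fresh-sym : ∀ {a b} → Fresh a b → Fresh b a
  fresh-sym (¬sv , a≢b′) = ¬sv ∘ sv-sym , λ b≡a′ → a≢b′ (trans (sym (α-invol _)) (cong opp (sym b≡a′)))

  data Walk (S : EdgeSet) : HalfEdge → HalfEdge → List HalfEdge → Set where
    done : ∀ {x y} → SameVertex M x y → Walk S x y []
    step : ∀ {x y c l} → SameVertex M x c → c ∈ S → Walk S (opp c) y l → Walk S x y (c ∷ l)

  walk-from : ∀ {S x x′ y l} → SameVertex M x′ x → Walk S x y l → Walk S x′ y l
  walk-from sv (done sv′)      = done (sv-trans sv sv′)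
  walk-from sv (step sv′ c∈ w) = step (sv-trans sv sv′) c∈ w

  record SimpleWalk (S : EdgeSet) (x y : HalfEdge) : Set where
    constructor simple
    field
      {edges}  : List HalfEdge
      walk     : Walk S x y edges
      distinct : AllPairs Fresh edges
      avoidEnd : All (λ c → ¬ SameVertex M c y) edges

  simple-from : ∀ {S x x′ y} → SameVertex M x′ x → SimpleWalk S x y → SimpleWalk S x′ y
  simple-from sv (simple w d a) = simple (walk-from sv w) d a

  simple-drop : ∀ {S x z y l} → Walk S x y l → AllPairs Fresh l → All (λ c → ¬ SameVertex M c y) l →
    Any (SameVertex M z) l → SimpleWalk S z y
  simple-drop (step sv c∈ w) d        a       (here zc)   = simple (step zc c∈ w) d a
  simple-drop (step sv c∈ w) (_ ∷ d) (_ ∷ a) (there any) = simple-drop w d a any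

  walk-next : ∀ {S x y l c} → Walk S x y l → c ∈ˡ l →
    SameVertex M (opp c) y ⊎ Any (SameVertex M (opp c)) l
  walk-next (step _ _ (done sv))     (here refl) = inj₁ sv
  walk-next (step _ _ (step sv _ _)) (here refl) = inj₂ (there (here sv))
  walk-next (step _ _ w) (there c∈) with walk-next w c∈
  ... | inj₁ sv  = inj₁ sv
  ... | inj₂ any = inj₂ (there any)

  -- If the vertex of `c` is the end or already occurs, the detour is dropped. Otherwise `c` is also
  -- new as an edge: were it the reverse of some `b` on the walk, the walk would visit the vertex of
  -- `c` right after `b`.
  simple-cons : ∀ {S c y} → c ∈ S → SimpleWalk S (opp c) y → SimpleWalk S c y
  simple-cons {S} {c} {y} c∈S (simple {l} w d a) with sameVertex? c y | Any.any? (sameVertex? c) l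
  ... | yes sv | _       = simple (done sv) [] []
  ... | no ¬sv | yes any = simple-drop w d a any
  ... | no ¬sv | no ¬any = simple (step sv-refl c∈S w) (All.tabulate fresh ∷ d) (¬sv ∷ a)
    where
      fresh : ∀ {b} → b ∈ˡ l → Fresh c b
      fresh {b} b∈l = (λ sv → ¬any (Any.map (λ { refl → sv }) b∈l)) , ¬opp
        where
          ¬opp : c ≢ opp b
          ¬opp c≡b′ with walk-next w b∈l
          ... | inj₁ sv  = ¬sv (subst (λ z → SameVertex M z y) (sym c≡b′) sv)
          ... | inj₂ any = ¬any (subst (λ z → Any (SameVertex M z) l) (sym c≡b′) any)

  conn-simple : ∀ {S x y} → Conn S x y → SimpleWalk S x y
  conn-simple ε = simple (done sv-refl) [] []
  conn-simple (inj₁ refl ◅ ss)               = simple-from (1 , refl) (conn-simple ss)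
  conn-simple (inj₂ (inj₁ refl) ◅ ss)        = simple-from sv-rot⁻¹ (conn-simple ss)
  conn-simple (inj₂ (inj₂ (x∈S , refl)) ◅ ss) = simple-cons x∈S (conn-simple ss)

  walk-∈ : ∀ {S x y l} → Walk S x y l → ∀ {c} → c ∈ˡ l → c ∈ S
  walk-∈ (step _ c∈ w) (here refl) = c∈
  walk-∈ (step _ _ w)  (there c∈)  = walk-∈ w c∈

  walk-links : ∀ {S h y l} → Walk S (opp h) y l → ∀ (i : Fin (length l)) →
    SameVertex M (opp (lookup (h ∷ l) (inject₁ i))) (lookup (h ∷ l) (suc i))
  walk-links (step sv _ w) zero    = sv
  walk-links (step _ _ w)  (suc i) = walk-links w i

  walk-closes : ∀ {S h y l} → Walk S (opp h) y l → SameVertex M (opp (lookup (h ∷ l) (fromℕ (length l)))) y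
  walk-closes (done sv)    = sv
  walk-closes (step _ _ w) = walk-closes w

  fresh-lookup : ∀ {l} → AllPairs Fresh l → ∀ i j → i ≢ j → Fresh (lookup l i) (lookup l j)
  fresh-lookup (f ∷ d) zero    zero    i≢j = contradiction refl i≢j
  fresh-lookup (f ∷ d) zero    (suc j) i≢j = All.lookup f (∈-lookup j)
  fresh-lookup (f ∷ d) (suc i) zero    i≢j = fresh-sym (All.lookup f (∈-lookup i))
  fresh-lookup (f ∷ d) (suc i) (suc j) i≢j = fresh-lookup d i j (i≢j ∘ cong suc)

  -- A detour around `h`, made simple, closes up with `h` to a cycle; `avoidEnd` keeps the vertex of
  -- `h` from recurring.
  acyclic-forest : ∀ {S} → AlphaInv M S → Acyclic M S → Forest S
  acyclic-forest {S} S-inv acyclic h h∈S conn with conn-simple (conn-sym (inv-∖ h S-inv) conn)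
  ... | simple {l} w d a = acyclic (length l) record
      { c             = lookup (h ∷ l)
      ; inS           = λ i → in-S (∈-lookup i)
      ; edgesDistinct = λ i j i≢j → (λ eq → proj₁ (fresh i j i≢j) (subst (SameVertex M _) eq sv-refl)) , proj₂ (fresh i j i≢j)
      ; links         = walk-links w
      ; closes        = walk-closes w
      ; vertsDistinct = λ i j i≢j → proj₁ (fresh i j i≢j)
      }
    where
      in-S : ∀ {x} → x ∈ˡ (h ∷ l) → x ∈ S
      in-S (here refl) = h∈S
      in-S (there x∈l) = proj₁ (∈-∖⁻ (walk-∈ w x∈l))
      fresh-h : ∀ {b} → b ∈ˡ l → Fresh h b
      fresh-h b∈l = (λ sv → All.lookup a b∈l (sv-sym sv)) ,
        λ h≡b′ → proj₂ (∈-∖⁻ (walk-∈ w b∈l)) (edge-sym (inj₂ h≡b′))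
      fresh = fresh-lookup (All.tabulate fresh-h ∷ d)

  forest-acyclic : ∀ {S} → AlphaInv M S → Forest S → Acyclic M S
  forest-acyclic {S} S-inv forest k cyc =
      forest (c zero) (inS zero) (conn-sym (inv-∖ (c zero) S-inv) (chain k c links others ◅◅ sv-conn closes))
    where
      open Cycle cyc
      others : ∀ i → c (suc i) ∈ S ∖ c zero
      others i = ∈-∖⁺ (inS (suc i)) λ { (inj₁ eq) → proj₁ (edgesDistinct (suc i) zero (λ ())) eq
                                     ; (inj₂ eq) → proj₂ (edgesDistinct (suc i) zero (λ ())) eq }
      chain : ∀ {S} k (c : Fin (suc k) → HalfEdge) →
        (∀ (i : Fin k) → SameVertex M (opp (c (inject₁ i))) (c (suc i))) → (∀ i → c (suc i) ∈ S) →
        Conn S (opp (c zero)) (opp (c (fromℕ k)))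
      chain zero    c link c∈ = ε
      chain (suc k) c link c∈ = sv-conn (link zero) ◅◅ conn-opp (c∈ zero) ◅◅ chain k (c ∘ suc) (link ∘ suc) (c∈ ∘ suc)

  toTree : ∀ {T} → SpanningTree M T → Tree T
  toTree (T-inv , T-conn , acyclic) = mkTree T-inv T-conn (acyclic-forest T-inv acyclic)

  fromTree : ∀ {T} → Tree T → SpanningTree M T
  fromTree (mkTree T-inv T-conn T-forest) = T-inv , T-conn , forest-acyclic T-inv T-forest

  -- The motion function and its tour.

  motion-∈ : ∀ {T x} → x ∈ T → motion M T x ≡ rot (opp x)
  motion-∈ x∈T rewrite x∈T = refl

  motion-∉ : ∀ {T x} → x ∉ T → motion M T x ≡ rot x
  motion-∉ x∉T rewrite x∉T = refl

  -- `rot` is injective, so a step backwards leads to the same edge even if the two trees treat that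
  -- edge differently.
  motion-edge : ∀ {T T′ x y} → motion M T x ≡ motion M T′ y → Edge x y
  motion-edge {T} {T′} {x} {y} eq with T x | T′ y
  ... | true  | true  = inj₁ (sym (opp-injective (rot-injective eq)))
  ... | true  | false = inj₂ (sym (rot-injective eq))
  ... | false | true  = edge-sym (inj₂ (rot-injective eq))
  ... | false | false = inj₁ (sym (rot-injective eq))

  motion-determines : ∀ {T T′ x y} → AlphaInv M T′ → T x ≡ T′ x →
    motion M T x ≡ motion M T′ y → x ≡ y
  motion-determines {T} {T′} {x} {y} inv′ agree eq with motion-edge {T} {T′} eq
  ... | inj₁ y≡x  = sym y≡x
  ... | inj₂ refl with T x | T′ x | T′ (opp x) | inv′ x
  ...   | true  | true  | true  | _ = opp-injective (rot-injective eq)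
  ...   | false | false | false | _ = rot-injective eq

  motion-injective : ∀ {T} → AlphaInv M T → ∀ {x y} → motion M T x ≡ motion M T y → x ≡ y
  motion-injective {T} T-inv = motion-determines {T} T-inv refl

  motion-conn : ∀ {T f x} → ¬ Edge f x → Conn (T ∖ f) x (motion M T x)
  motion-conn {T} {f} {x} ¬e with T x in eq
  ... | true  = conn-opp (∈-∖⁺ eq ¬e) ◅◅ conn-rot _
  ... | false = conn-rot x

  tour : EdgeSet → ℕ → HalfEdge
  tour T k = iter (motion M T) k root

  module _ {T : EdgeSet} (tree : Tree T) where

    private
      t : HalfEdge → HalfEdge
      t = motion M T

      t-injective : ∀ {x y} → t x ≡ t y → x ≡ y
      t-injective = motion-injective (inv tree)

    -- The motion enters the component of T − h beyond h through h, and can only leave it through opp h.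
    orbit-opp : ∀ {h} → h ∈ T → Σ ℕ λ k → iter t k h ≡ opp h
    orbit-opp {h} h∈T with period t t-injective h
    ... | p , _ , per = finish (explore p)
      where
        Found : Set
        Found = Σ ℕ λ k → iter t k h ≡ opp h
        ¬back : ¬ Conn (T ∖ h) (opp h) h
        ¬back c = forest tree h h∈T (conn-sym (inv-∖ h (inv tree)) c)
        explore : ∀ j → Conn (T ∖ h) (opp h) (iter t (suc j) h) ⊎ Found
        explore zero = inj₁ (subst (Conn _ _) (sym (motion-∈ {T} h∈T)) (conn-rot _))
        explore (suc j) with explore j
        ... | inj₂ found = inj₂ found
        ... | inj₁ c with edge? h (iter t (suc j) h)
        ...   | no ¬e         = inj₁ (c ◅◅ motion-conn ¬e)
        ...   | yes (inj₁ eq) = contradiction (subst (Conn _ _) eq c) ¬back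
        ...   | yes (inj₂ eq) = inj₂ (suc j , eq)
        finish : Conn (T ∖ h) (opp h) (iter t (suc p) h) ⊎ Found → Found
        finish (inj₁ c)     = contradiction (subst (Conn _ _) per c) ¬back
        finish (inj₂ found) = found

    Toured : HalfEdge → Set
    Toured h = Σ ℕ λ k → tour T k ≡ h

    toured-iter : ∀ {h} k → Toured h → Toured (iter t k h)
    toured-iter k (j , refl) = k + j , iter-+ t k j root

    toured-opp : ∀ {h} → h ∈ T → Toured h → Toured (opp h)
    toured-opp h∈T th = let k , eq = orbit-opp h∈T in subst Toured eq (toured-iter k th)

    -- For `h` in `T`, one motion step from `opp h` yields `rot h`, and `opp h` is toured by
    -- `orbit-opp`.
    toured-rot : ∀ {h} → Toured h → Toured (rot h)
    toured-rot {h} th with member T h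
    ... | inj₁ h∈T = subst Toured
          (trans (motion-∈ {T} (trans (inv tree h) h∈T)) (cong rot (α-invol h))) (toured-iter 1 (toured-opp h∈T th))
    ... | inj₂ h∉T = subst Toured (motion-∉ {T} h∉T) (toured-iter 1 th)

    toured-iter-rot : ∀ {h} k → Toured h → Toured (iter rot k h)
    toured-iter-rot zero    th = th
    toured-iter-rot (suc k) th = toured-rot (toured-iter-rot k th)

    toured-conn : ∀ {x y} → Conn T x y → Toured x → Toured y
    toured-conn ε tx = tx
    toured-conn (inj₁ refl ◅ ss) tx = toured-conn ss (toured-rot tx)
    toured-conn (inj₂ (inj₁ refl) ◅ ss) tx =
      toured-conn ss (let k , eq = sv-rot⁻¹ in subst Toured eq (toured-iter-rot k tx))
    toured-conn (inj₂ (inj₂ (x∈T , refl)) ◅ ss) tx = toured-conn ss (toured-opp x∈T tx)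

    toured : ∀ h → Toured h
    toured h = toured-conn (conn tree root h) (0 , refl)

    tour-period-≥ : ∀ {p} → tour T (suc p) ≡ root → n ≤ suc p
    tour-period-≥ {p} per = injective⇒≤ {f = index} index-injective
      where
        bounded : ∀ h → Σ ℕ λ j → j < suc p × tour T j ≡ h
        bounded h with toured h
        ... | k , eq with iter-reduce t {p} {root} per k
        ...   | j , j<p , eq′ = j , j<p , trans eq′ eq
        index : HalfEdge → Fin (suc p)
        index h = fromℕ< (proj₁ (proj₂ (bounded h)))
        index-toured : ∀ h → tour T (toℕ (index h)) ≡ h
        index-toured h = trans (cong (tour T) (toℕ-fromℕ< (proj₁ (proj₂ (bounded h))))) (proj₂ (proj₂ (bounded h)))
        index-injective : ∀ {x y} → index x ≡ index y → x ≡ y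
        index-injective {x} {y} eq = trans (sym (index-toured x)) (trans (cong (tour T ∘ toℕ) eq) (index-toured y))

    tour-period : tour T n ≡ root
    tour-period with period t t-injective root
    ... | p , p<n , per = subst (λ k → tour T k ≡ root) (≤-antisym p<n (tour-period-≥ per)) per

    position : ∀ h → Σ ℕ λ k → k < n × tour T k ≡ h
    position h with toured h | period t t-injective root
    ... | k , eq | p , p<n , per with iter-reduce t per k
    ...   | j , j≤p , eq′ = j , <-≤-trans j≤p p<n , trans eq′ eq

    tour-distinct : ∀ {i j} → i < j → j < n → tour T i ≢ tour T j
    tour-distinct i<j j<n eq with iter-cancel t t-injective {x = root} i<j eq
    ... | d , d<j , per = <-irrefl refl (<-≤-trans j<n (≤-trans (tour-period-≥ per) d<j))

    tour-injective : ∀ {i j} → i < n → j < n → tour T i ≡ tour T j → i ≡ j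
    tour-injective {i} {j} i<n j<n eq with <-cmp i j
    ... | tri< i<j _ _ = contradiction eq (tour-distinct i<j j<n)
    ... | tri≈ _ i≡j _ = i≡j
    ... | tri> _ _ j<i = contradiction (sym eq) (tour-distinct j<i i<n)

    -- The chord diagram of the tour.

    record Chord (h : HalfEdge) : Set where
      constructor chord
      field
        {lo hi} : ℕ
        lo<hi   : lo < hi
        hi<n    : hi < n
        at-lo   : Edge h (tour T lo)
        at-hi   : Edge h (tour T hi)
        only    : ∀ {j} → j < n → Edge h (tour T j) → j ≡ lo ⊎ j ≡ hi

      lo<n : lo < n
      lo<n = <-trans lo<hi hi<n

      between : ∀ {j} → j < n → Edge h (tour T j) → lo ≤ j × j ≤ hi
      between j<n e with only j<n e
      ... | inj₁ refl = ≤-refl , <⇒≤ lo<hi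
      ... | inj₂ refl = <⇒≤ lo<hi , ≤-refl

    opaque
      chord-of : ∀ h → Chord h
      chord-of h with position h | position (opp h)
      ... | a , a<n , eqa | b , b<n , eqb with <-cmp a b
      ...   | tri< a<b _ _ = chord a<b b<n (inj₁ eqa) (inj₂ eqb) λ
              { j<n (inj₁ eq) → inj₁ (tour-injective j<n a<n (trans eq (sym eqa)))
              ; j<n (inj₂ eq) → inj₂ (tour-injective j<n b<n (trans eq (sym eqb))) }
      ...   | tri≈ _ refl _ = contradiction (trans (sym eqb) eqa) (α-fpf h)
      ...   | tri> _ _ b<a = chord b<a a<n (inj₂ eqb) (inj₁ eqa) λ
              { j<n (inj₁ eq) → inj₂ (tour-injective j<n a<n (trans eq (sym eqa)))
              ; j<n (inj₂ eq) → inj₁ (tour-injective j<n b<n (trans eq (sym eqb))) }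

    tour-segment : ∀ {f i} d → (∀ j → i ≤ j → j < d + i → ¬ Edge f (tour T j)) →
      Conn (T ∖ f) (tour T i) (tour T (d + i))
    tour-segment zero    avoid = ε
    tour-segment {f} {i} (suc d) avoid =
      tour-segment d (λ j i≤j j<d → avoid j i≤j (<-trans j<d (n<1+n _)))
      ◅◅ motion-conn (avoid (d + i) (m≤n+m i d) (n<1+n _))

    tour-conn : ∀ {f i k} → i ≤ k → (∀ j → i ≤ j → j < k → ¬ Edge f (tour T j)) →
      Conn (T ∖ f) (tour T i) (tour T k)
    tour-conn {f} {i} {k} i≤k = subst
      (λ m → (∀ j → i ≤ j → j < m → ¬ Edge f (tour T j)) → Conn (T ∖ f) (tour T i) (tour T m))
      (m∸n+n≡m i≤k) (tour-segment {f} {i} (k ∸ i))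

    chord-conn : ∀ {f e} (ch : Chord e) → Conn (T ∖ f) (tour T (Chord.lo ch)) (tour T (Chord.hi ch)) →
      Conn (T ∖ f) e (opp e)
    chord-conn {f} {e} (chord {lo} {hi} lo<hi hi<n at-lo at-hi _) c = go at-lo at-hi
      where
        distinct = tour-distinct lo<hi hi<n
        go : Edge e (tour T lo) → Edge e (tour T hi) → Conn (T ∖ f) e (opp e)
        go (inj₁ p) (inj₁ q) = contradiction (trans p (sym q)) distinct
        go (inj₁ p) (inj₂ q) = subst (λ x → Conn _ x (opp e)) p (subst (Conn _ _) q c)
        go (inj₂ p) (inj₁ q) = conn-sym (inv-∖ f (inv tree)) (subst (λ x → Conn _ x e) p (subst (Conn _ _) q c))
        go (inj₂ p) (inj₂ q) = contradiction (trans p (sym q)) distinct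

    -- The arc between the endpoints of `f` stays in one component of T - f, so a chord within it
    -- cannot join the two components.
    ¬chord-inside : ∀ {f e} → Exch T f e → e ∉ T → (cf : Chord f) (ce : Chord e) →
      ¬ (Chord.lo cf < Chord.lo ce × Chord.hi ce < Chord.hi cf)
    ¬chord-inside ex e∉T cf ce (lo<lo , hi<hi) = exch-cut (inv tree) ex e∉T (chord-conn ce (tour-conn (<⇒≤ E.lo<hi) avoid))
      where
        module F = Chord cf
        module E = Chord ce
        avoid : ∀ j → E.lo ≤ j → j < E.hi → ¬ Edge _ (tour T j)
        avoid j lo≤j j<hi ed with F.only (<-trans j<hi E.hi<n) ed
        ... | inj₁ refl = <-irrefl refl (<-≤-trans lo<lo lo≤j)
        ... | inj₂ refl = <-irrefl refl (<-trans j<hi hi<hi)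

    -- The same for the complementary arc, which wraps around: position `n` is the root again.
    ¬chord-outside : ∀ {f e} → Exch T f e → e ∉ T → (cf : Chord f) (ce : Chord e) →
      ¬ (Chord.lo ce < Chord.lo cf × Chord.hi cf < Chord.hi ce)
    ¬chord-outside {f} ex e∉T cf ce (lo<lo , hi<hi) = exch-cut (inv tree) ex e∉T (chord-conn ce
        (conn-sym (inv-∖ f (inv tree)) (tour-conn (<⇒≤ E.hi<n) after ◅◅ wrap (tour-conn z≤n before))))
      where
        module F = Chord cf
        module E = Chord ce
        wrap : Conn (T ∖ f) root (tour T E.lo) → Conn (T ∖ f) (tour T n) (tour T E.lo)
        wrap = subst (λ x → Conn (T ∖ f) x (tour T E.lo)) (sym tour-period)
        after : ∀ j → E.hi ≤ j → j < n → ¬ Edge f (tour T j)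
        after j hi≤j j<n ed with F.only j<n ed
        ... | inj₁ refl = <-irrefl refl (<-≤-trans (<-trans F.lo<hi hi<hi) hi≤j)
        ... | inj₂ refl = <-irrefl refl (<-≤-trans hi<hi hi≤j)
        before : ∀ j → 0 ≤ j → j < E.lo → ¬ Edge f (tour T j)
        before j _ j<lo ed with F.only (<-trans j<lo E.lo<n) ed
        ... | inj₁ refl = <-irrefl refl (<-trans j<lo lo<lo)
        ... | inj₂ refl = <-irrefl refl (<-trans j<lo (<-trans lo<lo F.lo<hi))

  -- Fundamental cycles and cocycles; activity in backward form.

  tree-≐ : ∀ {S S′} → S ⊆ S′ → S′ ⊆ S → AlphaInv M S′ → Tree S → Tree S′
  tree-≐ S⊆S′ S′⊆S inv′ tree = mkTree inv′ (λ x y → conn-mono S⊆S′ (conn tree x y)) (forest-⊆ S′⊆S (forest tree))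

  exch-edge : ∀ {T f f′ e e′} → AlphaInv M T → Edge f f′ → Edge e e′ → Exch T f e → Exch T f′ e′
  exch-edge {T} {f} {f′} {e} {e′} T-inv ff′ ee′ = tree-≐ (mono ff′ ee′) (mono (edge-sym ff′) (edge-sym ee′))
      (inv-⊕ e′ (inv-∖ f′ T-inv))
    where
      mono : ∀ {f f′ e e′} → Edge f f′ → Edge e e′ → T ∖ f ⊕ e ⊆ T ∖ f′ ⊕ e′
      mono ff′ ee′ x x∈ with ∈-⊕⁻ x∈
      ... | inj₂ ex = ∈-⊕ʳ (edge-trans (edge-sym ee′) ex)
      ... | inj₁ x∈∖ with ∈-∖⁻ x∈∖
      ...   | x∈T , ¬fx = ∈-⊕ˡ (∈-∖⁺ x∈T λ f′x → ¬fx (edge-trans ff′ f′x))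

  -- x lies in the fundamental cocycle of h (h internal) or in its fundamental cycle (h external).
  Fund : EdgeSet → HalfEdge → HalfEdge → Set
  Fund T h x = (h ∈ T × Exch T h x) ⊎ (h ∉ T × Exch T x h)

  fund-edge : ∀ {T h h′ x x′} → AlphaInv M T → Edge h h′ → Edge x x′ → Fund T h x → Fund T h′ x′
  fund-edge T-inv hh′ xx′ (inj₁ (h∈T , ex)) = inj₁ (trans (inv-edge T-inv hh′) h∈T , exch-edge T-inv hh′ xx′ ex)
  fund-edge T-inv hh′ xx′ (inj₂ (h∉T , ex)) = inj₂ (trans (inv-edge T-inv hh′) h∉T , exch-edge T-inv xx′ hh′ ex)

  -- With `x` in `T` the exchanged set would lie inside T - h, where the ends of `h` are separated.
  cocycle-external : ∀ {T h x} → Tree T → h ∈ T → ¬ Edge h x → Exch T h x → x ∉ T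
  cocycle-external {T} {h} {x} tree h∈T ¬e ex with member T x
  ... | inj₂ x∉T = x∉T
  ... | inj₁ x∈T = ⊥-elim (forest tree h h∈T (conn-mono sub (conn ex h (opp h))))
    where
      sub : T ∖ h ⊕ x ⊆ T ∖ h
      sub y y∈ with ∈-⊕⁻ y∈
      ... | inj₁ y∈∖ = y∈∖
      ... | inj₂ xy  = trans (inv-edge (inv-∖ h (inv tree)) xy) (∈-∖⁺ x∈T ¬e)

  Later : EdgeSet → ℕ → HalfEdge → Set
  Later T k x = Σ ℕ λ j → k < j × j < n × Edge x (tour T j)

  later? : ∀ T k x → Dec (Later T k x)
  later? T k x = map′ (λ (i , k<i , e) → toℕ i , k<i , toℕ<n i , e) bounded
      (any? λ (i : Fin n) → (k <? toℕ i) ×-dec edge? x (tour T (toℕ i)))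
    where
      bounded : Later T k x → ∃ λ (i : Fin n) → k < toℕ i × Edge x (tour T (toℕ i))
      bounded (j , k<j , j<n , e) = fromℕ< j<n ,
        subst (λ m → k < m × Edge x (tour T m)) (sym (toℕ-fromℕ< j<n)) (k<j , e)

  -- Minimality seen from the end of the tour, with `k` meant to be a position of `h`.
  ActiveAt : EdgeSet → ℕ → HalfEdge → Set
  ActiveAt T k h = ∀ x → Fund T h x → ¬ Edge h x → Later T k x

  activeAt-edge : ∀ {T k h h′} → AlphaInv M T → Edge h h′ → ActiveAt T k h → ActiveAt T k h′
  activeAt-edge T-inv hh′ act x fund ¬e =
    act x (fund-edge T-inv (edge-sym hh′) (inj₁ refl) fund) λ hx → ¬e (edge-trans (edge-sym hh′) hx)

  module _ {T : EdgeSet} {h : HalfEdge} (tree : Tree T) where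

    -- The deleted edge is `h` if `h` is internal and `x` otherwise, so inside and outside swap
    -- roles between the cases.
    ¬nested : ∀ {x} → Fund T h x → ¬ Edge h x → (ch : Chord tree h) (cx : Chord tree x) →
      ¬ (Chord.lo ch < Chord.lo cx × Chord.hi cx < Chord.hi ch)
    ¬nested (inj₁ (h∈T , ex)) ¬e ch cx = ¬chord-inside tree ex (cocycle-external tree h∈T ¬e ex) ch cx
    ¬nested (inj₂ (h∉T , ex)) ¬e ch cx = ¬chord-outside tree ex h∉T cx ch

    ¬nesting : ∀ {x} → Fund T h x → ¬ Edge h x → (ch : Chord tree h) (cx : Chord tree x) →
      ¬ (Chord.lo cx < Chord.lo ch × Chord.hi ch < Chord.hi cx)
    ¬nesting (inj₁ (h∈T , ex)) ¬e ch cx = ¬chord-outside tree ex (cocycle-external tree h∈T ¬e ex) ch cx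
    ¬nesting (inj₂ (h∉T , ex)) ¬e ch cx = ¬chord-inside tree ex h∉T cx ch

    -- Minimality puts the first endpoint of `h` before that of `x`. The chords cross, so the last
    -- endpoint of `x` lies beyond both positions of `h`.
    minimal⇒activeAt : MinimalIn M T (Fund T h) h → ∀ {k} → k < n → Edge h (tour T k) → ActiveAt T k h
    minimal⇒activeAt (k₀ , k₀<n , at-k₀ , first) {k} k<n at-k x fund ¬e = result (X.hi ≤? C.hi)
      where
        ch = chord-of tree h
        cx = chord-of tree x
        module C = Chord ch
        module X = Chord cx
        disjoint : ∀ {i j} → Edge h (tour T i) → Edge x (tour T j) → i ≢ j
        disjoint e e′ refl = ¬e (edge-trans e (edge-sym e′))
        lo<lo : C.lo < X.lo
        lo<lo = ≤∧≢⇒< (≤-trans (proj₁ (C.between k₀<n (edge-inEdge at-k₀)))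
                  (≮⇒≥ λ lo<k₀ → first X.lo lo<k₀ (fund-edge (inv tree) (inj₁ refl) X.at-lo fund)))
                (disjoint C.at-lo X.at-lo)
        result : Dec (X.hi ≤ C.hi) → Later T k x
        result (yes hi≤hi) = contradiction (lo<lo , ≤∧≢⇒< hi≤hi (disjoint C.at-hi X.at-hi ∘ sym)) (¬nested fund ¬e ch cx)
        result (no hi≰hi)  = X.hi , ≤-<-trans (proj₂ (C.between k<n at-k)) (≰⇒> hi≰hi) , X.hi<n , X.at-hi

    activeAt⇒minimal : (∀ k → k < n → Edge h (tour T k) → ActiveAt T k h) → MinimalIn M T (Fund T h) h
    activeAt⇒minimal act = C.lo , C.lo<n , inEdge-true C.at-lo , first
      where
        ch = chord-of tree h
        module C = Chord ch
        first : ∀ j → j < C.lo → ¬ Fund T h (tour T j)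
        -- Activity is used at the last endpoint of `h`: an edge met both before `C.lo` and after
        -- `C.hi` would have a chord enclosing that of `h`.
        first j j<lo fund = contra (act C.hi C.hi<n C.at-hi (tour T j) fund ¬e)
          where
            j<n = <-trans j<lo C.lo<n
            ¬e : ¬ Edge h (tour T j)
            ¬e e with C.only j<n e
            ... | inj₁ refl = <-irrefl refl j<lo
            ... | inj₂ refl = <-irrefl refl (<-trans j<lo C.lo<hi)
            cx = chord-of tree (tour T j)
            module X = Chord cx
            contra : ¬ Later T C.hi (tour T j)
            contra (v , hi<v , v<n , e) = ¬nesting fund ¬e ch cx (lo<lo , hi<hi)
              where
                lo<lo = ≤-<-trans (proj₁ (X.between j<n (inj₁ refl))) j<lo
                hi<hi = <-≤-trans hi<v (proj₂ (X.between v<n e))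

  opaque
    unfolding _∖_

    exch⇒spanning : ∀ {T f e} → Exch T f e → SpanningTree M (addEdge M (removeEdge M T f) e)
    exch⇒spanning = fromTree

    spanning⇒exch : ∀ {T f e} → SpanningTree M (addEdge M (removeEdge M T f) e) → Exch T f e
    spanning⇒exch = toTree

  minimalIn-⊆ : ∀ {T h} {C D : HalfEdge → Set} → (∀ x → D x → C x) → MinimalIn M T C h → MinimalIn M T D h
  minimalIn-⊆ {T} D⊆C (k , k<n , at-k , first) = k , k<n , at-k , λ j j<k → first j j<k ∘ D⊆C (tour T j)

  interval⇒activeAt : ∀ {T S h k} → Tree T → InInterval M T S → T h ≢ S h →
    k < n → Edge h (tour T k) → ActiveAt T k h
  interval⇒activeAt {T} {S} {h} tree (_ , internal , external) T≢S with member T h | member S h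
  ... | inj₁ h∈T | inj₁ h∈S = contradiction (trans h∈T (sym h∈S)) T≢S
  ... | inj₂ h∉T | inj₂ h∉S = contradiction (trans h∉T (sym h∉S)) T≢S
  ... | inj₁ h∈T | inj₂ h∉S = minimal⇒activeAt tree (minimalIn-⊆ cocycle (proj₂ (internal h h∈T h∉S)))
    where
      cocycle : ∀ x → Fund T h x → InFundCocycle M T h x
      cocycle _ (inj₁ (_ , ex))   = exch⇒spanning ex
      cocycle _ (inj₂ (h∉T , _)) = ⊥-elim (clash h∈T h∉T)
  ... | inj₂ h∉T | inj₁ h∈S = minimal⇒activeAt tree (minimalIn-⊆ cycle (proj₂ (external h h∉T h∈S)))
    where
      cycle : ∀ x → Fund T h x → InFundCycle M T h x
      cycle _ (inj₂ (_ , ex))   = exch⇒spanning ex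
      cycle _ (inj₁ (h∈T , _)) = ⊥-elim (clash h∈T h∉T)

  -- Comparison of trees along the backward tour; uniqueness.

  Agree : EdgeSet → EdgeSet → ℕ → Set
  Agree T T′ k = ∀ j → k ≤ j → j < n → T (tour T j) ≡ T′ (tour T j)

  -- Backward induction from position `n`, where both tours are back at the root.
  agree-tour : ∀ {T T′ k} → Tree T → Tree T′ → Agree T T′ k →
    ∀ j → k ≤ j → j ≤ n → tour T j ≡ tour T′ j
  agree-tour {T} {T′} {k} tree tree′ agree j k≤j j≤n = go (n ∸ j) j (m∸n+n≡m j≤n) k≤j
    where
      go : ∀ d j → d + j ≡ n → k ≤ j → tour T j ≡ tour T′ j
      go zero    j refl k≤j = trans (tour-period tree) (sym (tour-period tree′))
      go (suc d) j eq   k≤j = motion-determines {T} (inv tree′)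
        (agree j k≤j (subst (j <_) eq (s≤s (m≤n+m j d))))
        (go d (suc j) (trans (+-suc d j) eq) (≤-trans k≤j (<⇒≤ (n<1+n j))))

  -- At `k` itself the trees may differ, so the tours may reach this edge through different
  -- half-edges.
  agree-edge : ∀ {T T′ k} → Tree T → Tree T′ → Agree T T′ (suc k) → k < n → Edge (tour T k) (tour T′ k)
  agree-edge {T} {T′} tree tree′ agree k<n = motion-edge {T} {T′} (agree-tour tree tree′ agree _ ≤-refl k<n)

  agree-sym : ∀ {T T′ k} → Tree T → Tree T′ → Agree T T′ k → Agree T′ T k
  agree-sym {T} {T′} tree tree′ agree j k≤j j<n =
    subst (λ x → T′ x ≡ T x) (agree-tour tree tree′ agree j k≤j (<⇒≤ j<n)) (sym (agree j k≤j j<n))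

  -- If `y` is in `S`, it is active for `T′`, and `exchange-in` finds an edge of T′ - T in its
  -- fundamental cycle; otherwise it is active for `T`, and `exchange-out` finds one in its
  -- fundamental cocycle. Activity puts that edge after `k`, where the trees agree.
  no-last-difference : ∀ {S T T′ k y} → Tree T → Tree T′ → InInterval M T S → InInterval M T′ S →
    Agree T T′ (suc k) → k < n → Edge y (tour T k) → Edge y (tour T′ k) → y ∈ T → y ∉ T′ → ⊥
  no-last-difference {S} {T} {T′} {k} {y} tree tree′ int int′ agree k<n at at′ y∈T y∉T′ with member S y
  ... | inj₁ y∈S with exchange-in tree tree′ y∈T y∉T′
  ...   | f , f∈T′ , f∉T , ex
        with interval⇒activeAt tree′ int′ (λ eq → clash (trans eq y∈S) y∉T′) k<n at′ f (inj₂ (y∉T′ , ex))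
               (λ yf → clash f∈T′ (trans (inv-edge (inv tree′) yf) y∉T′))
  ...     | j , k<j , j<n , fj = clash
            (trans (sym (agree-sym tree tree′ agree j k<j j<n)) (trans (inv-edge (inv tree′) fj) f∈T′))
            (trans (inv-edge (inv tree) fj) f∉T)
  no-last-difference {S} {T} {T′} {k} {y} tree tree′ int int′ agree k<n at at′ y∈T y∉T′
    | inj₂ y∉S with exchange-out tree tree′ y∈T y∉T′
  ...   | f , f∈T′ , f∉T , ex
        with interval⇒activeAt tree int (λ eq → clash y∈T (trans eq y∉S)) k<n at f (inj₁ (y∈T , ex))
               (λ yf → clash (trans (inv-edge (inv tree) yf) y∈T) f∉T)
  ...     | j , k<j , j<n , fj = clash
            (trans (agree j k<j j<n) (trans (inv-edge (inv tree′) fj) f∈T′))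
            (trans (inv-edge (inv tree) fj) f∉T)

  interval-unique : ∀ {S T T′} → Tree T → Tree T′ → InInterval M T S → InInterval M T′ S → ∀ h → T h ≡ T′ h
  interval-unique {S} {T} {T′} tree tree′ int int′ h with position tree h
  ... | k , k<n , refl = agree-from n 0 (+-identityʳ n) k z≤n k<n
    where
      same : ∀ {k} → Agree T T′ (suc k) → k < n → T (tour T k) ≡ T′ (tour T k)
      same {k} agree k<n with member T (tour T k) | member T′ (tour T k) | agree-edge tree tree′ agree k<n
      ... | inj₁ y∈T | inj₁ y∈T′ | _ = trans y∈T (sym y∈T′)
      ... | inj₂ y∉T | inj₂ y∉T′ | _ = trans y∉T (sym y∉T′)
      ... | inj₁ y∈T | inj₂ y∉T′ | e = ⊥-elim
            (no-last-difference tree tree′ int int′ agree k<n (inj₁ refl) e y∈T y∉T′)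
      ... | inj₂ y∉T | inj₁ y∈T′ | e = ⊥-elim
            (no-last-difference tree′ tree int′ int (agree-sym tree tree′ agree) k<n e (inj₁ refl) y∈T′ y∉T)
      agree-from : ∀ d k → d + k ≡ n → Agree T T′ k
      agree-from zero    k refl j k≤j j<n = ⊥-elim (<-irrefl refl (<-≤-trans j<n k≤j))
      agree-from (suc d) k eq   j k≤j j<n with m≤n⇒m<n∨m≡n k≤j
      ... | inj₁ k<j  = agree-from d (suc k) (trans (+-suc d k) eq) j k<j j<n
      ... | inj₂ refl = same (agree-from d (suc k) (trans (+-suc d k) eq)) j<n

  -- Existence: building a tree by backward exchanges.

  exch-elsewhere : ∀ {T f e z} → ¬ Edge f z → ¬ Edge e z → (T ∖ f ⊕ e) z ≡ T z
  exch-elsewhere {T} {f} {e} {z} ¬fz ¬ez with member T z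
  ... | inj₁ z∈T = trans (∈-⊕ˡ (∈-∖⁺ z∈T ¬fz)) (sym z∈T)
  ... | inj₂ z∉T = trans (notMember {T ∖ f ⊕ e} z∉) (sym z∉T)
    where
      z∉ : ¬ z ∈ T ∖ f ⊕ e
      z∉ z∈ with ∈-⊕⁻ z∈
      ... | inj₁ z∈∖ = clash (proj₁ (∈-∖⁻ z∈∖)) z∉T
      ... | inj₂ ez  = ¬ez ez

  exch-removed : ∀ {T f e} → ¬ Edge e f → f ∉ T ∖ f ⊕ e
  exch-removed {T} {f} {e} ¬ef = notMember {T ∖ f ⊕ e} f∉
    where
      f∉ : ¬ f ∈ T ∖ f ⊕ e
      f∉ f∈ with ∈-⊕⁻ f∈
      ... | inj₁ f∈∖ = proj₂ (∈-∖⁻ f∈∖) (inj₁ refl)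
      ... | inj₂ ef  = ¬ef ef

  fund-swap : ∀ {T y x} → Fund T y x → ¬ Edge y x → Σ EdgeSet λ T′ →
    Tree T′ × T′ y ≡ not (T y) × (∀ {z} → ¬ Edge y z → ¬ Edge x z → T z ≡ T′ z)
  fund-swap {T} {y} {x} (inj₁ (y∈T , ex)) ¬e = T ∖ y ⊕ x , ex ,
    trans (exch-removed (¬e ∘ edge-sym)) (cong not (sym y∈T)) , λ ¬yz ¬xz → sym (exch-elsewhere ¬yz ¬xz)
  fund-swap {T} {y} {x} (inj₂ (y∉T , ex)) ¬e = T ∖ x ⊕ y , ex ,
    trans (∈-⊕ʳ (inj₁ refl)) (cong not (sym y∉T)) , λ ¬yz ¬xz → sym (exch-elsewhere ¬xz ¬yz)

  -- `exch` and `exch-cut` turn the spanning tree condition into separation of two ends, which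
  -- `conn?` decides.
  fund? : ∀ {T} → Tree T → ∀ h x → Dec (Fund T h x × ¬ Edge h x)
  fund? {T} tree h x with edge? h x
  ... | yes e = no λ (_ , ¬e) → ¬e e
  ... | no ¬e with member T h
  ...   | inj₁ h∈T = map′ (λ (x∉T , ¬c) → inj₁ (h∈T , exch tree ¬c) , ¬e) cut
            ((T x ≟ᵇ false) ×-dec ¬? (conn? (inv-∖ h (inv tree)) x (opp x)))
    where
      cut : Fund T h x × ¬ Edge h x → x ∉ T × ¬ Conn (T ∖ h) x (opp x)
      cut (inj₁ (_ , ex) , _) = let x∉T = cocycle-external tree h∈T ¬e ex in x∉T , exch-cut (inv tree) ex x∉T
      cut (inj₂ (h∉T , _) , _) = ⊥-elim (clash h∈T h∉T)
  ...   | inj₂ h∉T = map′ (λ ¬c → inj₂ (h∉T , exch tree ¬c) , ¬e) cut (¬? (conn? (inv-∖ x (inv tree)) h (opp h)))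
    where
      cut : Fund T h x × ¬ Edge h x → ¬ Conn (T ∖ x) h (opp h)
      cut (inj₁ (h∈T , _) , _) = ⊥-elim (clash h∈T h∉T)
      cut (inj₂ (_ , ex) , _) = exch-cut (inv tree) ex h∉T

  -- Activity at position k depends only on the part of the tree toured from k onwards.
  activeAt-agree : ∀ {T T′ k w} → Tree T → Tree T′ → Agree T T′ (suc k) → T w ≡ T′ w →
    ActiveAt T k w → ActiveAt T′ k w
  activeAt-agree {T} {T′} {k} {w} tree tree′ agree same act x (inj₁ (w∈T′ , ex)) ¬e
    -- Let U = T′ - w + x. As `w` is in `T` but not in U, some `g` of U - T lies in the fundamental
    -- cocycle of `w` for `T`. It is met after `k`, where the trees agree, so it is not in `T′` and
    -- must be `x`.
    with exchange-out tree ex (trans same w∈T′) (exch-removed (¬e ∘ edge-sym))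
  ... | g , g∈U , g∉T , exg with act g (inj₁ (trans same w∈T′ , exg))
                                    (λ wg → clash (trans (inv-edge (inv tree) wg) (trans same w∈T′)) g∉T)
  ...   | j , k<j , j<n , gj with ∈-⊕⁻ g∈U
  ...     | inj₁ g∈∖ = ⊥-elim (clash (trans (agree j k<j j<n) (trans (inv-edge (inv tree′) gj) (proj₁ (∈-∖⁻ g∈∖))))
                                     (trans (inv-edge (inv tree) gj) g∉T))
  ...     | inj₂ xg  = j , k<j , j<n ,
              subst (Edge x) (agree-tour tree tree′ agree j k<j (<⇒≤ j<n)) (edge-trans xg gj)
  activeAt-agree {T} {T′} {k} {w} tree tree′ agree same act x (inj₂ (w∉T′ , ex)) ¬e
    -- Dually, U = T′ - x + w contains `w` and `T` does not, so some `f` of T - U lies in the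
    -- fundamental cycle of `w` for `T`. Met after `k`, it is in `T′`, and only `x` is then missing
    -- from U.
    with exchange-in ex tree (∈-⊕ʳ (inj₁ refl)) (trans same w∉T′)
  ... | f , f∈T , f∉U , exf with act f (inj₂ (trans same w∉T′ , exf))
                                    (λ wf → clash f∈T (trans (inv-edge (inv tree) wf) (trans same w∉T′)))
  ...   | j , k<j , j<n , fj with edge? x f
  ...     | yes xf = j , k<j , j<n ,
              subst (Edge x) (agree-tour tree tree′ agree j k<j (<⇒≤ j<n)) (edge-trans xf fj)
  ...     | no ¬xf = ⊥-elim (clash (∈-⊕ˡ (∈-∖⁺ f∈T′ ¬xf)) f∉U)
    where
      f∈T′ : f ∈ T′
      f∈T′ = trans (sym (inv-edge (inv tree′) fj)) (trans (sym (agree j k<j j<n)) (trans (inv-edge (inv tree) fj) f∈T))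

  -- Invariant of the construction: vacuous at `k` = `n`, and the interval condition at `k` = 0.
  ActiveFrom : EdgeSet → EdgeSet → ℕ → Set
  ActiveFrom S T k = ∀ j → k ≤ j → j < n → T (tour T j) ≢ S (tour T j) → ActiveAt T j (tour T j)

  extend : ∀ {S T k} → ActiveFrom S T (suc k) → (T (tour T k) ≢ S (tour T k) → ActiveAt T k (tour T k)) →
    ActiveFrom S T k
  extend from at-k j k≤j j<n with m≤n⇒m<n∨m≡n k≤j
  ... | inj₁ k<j  = from j k<j j<n
  ... | inj₂ refl = at-k

  -- If the edge at `k` is wrong and inactive, some `x` of its fundamental (co)cycle is not met
  -- later. Exchanging the two corrects position `k` and leaves the later part of the tour
  -- unchanged, so activities there survive by `activeAt-agree`.
  improve : ∀ {S T k} → AlphaInv M S → k < n → Tree T → ActiveFrom S T (suc k) →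
    Σ EdgeSet λ T′ → Tree T′ × ActiveFrom S T′ k
  improve {S} {T} {k} S-inv k<n tree from with T (tour T k) ≟ᵇ S (tour T k)
  ... | yes eq = T , tree , extend {S} from (λ neq → contradiction eq neq)
  ... | no T≢S with any? (λ x → fund? tree (tour T k) x ×-dec ¬? (later? T k x))
  ...   | no none = T , tree , extend {S} from λ _ x fund ¬e →
            decidable-stable (later? T k x) λ ¬l → none (x , (fund , ¬e) , ¬l)
  ...   | yes (x , (fund , ¬e) , ¬l) with fund-swap fund ¬e
  ...     | T′ , tree′ , flip , elsewhere = T′ , tree′ , extend {S} from′ λ neq → contradiction at-k neq
    where
      y = tour T k
      -- Were `y` met again at a later `j`, it would be active there by the invariant, so `x` would
      -- be met after `j`, contrary to its choice.
      ¬yj : ∀ {j} → k < j → j < n → ¬ Edge y (tour T j)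
      ¬yj {j} k<j j<n yj with from j k<j j<n
          (λ eq → T≢S (trans (sym (inv-edge (inv tree) yj)) (trans eq (inv-edge S-inv yj))))
          x (fund-edge (inv tree) yj (inj₁ refl) fund) (λ jx → ¬e (edge-trans yj jx))
      ... | i , j<i , i<n , xi = ¬l (i , <-trans k<j j<i , i<n , xi)
      agree : Agree T T′ (suc k)
      agree j k<j j<n = elsewhere (¬yj k<j j<n) λ xj → ¬l (j , k<j , j<n , xj)
      -- `tour T′ k` may be the other half-edge of `y`, hence the transport along the edge.
      at-k : T′ (tour T′ k) ≡ S (tour T′ k)
      at-k = begin
        T′ (tour T′ k)   ≡⟨ inv-edge (inv tree′) (agree-edge tree tree′ agree k<n) ⟩
        T′ y             ≡⟨ flip ⟩
        not (T y)        ≡⟨ sym (¬-not (T≢S ∘ sym)) ⟩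
        S y              ≡⟨ sym (inv-edge S-inv (agree-edge tree tree′ agree k<n)) ⟩
        S (tour T′ k)    ∎
        where open ≡-Reasoning
      from′ : ActiveFrom S T′ (suc k)
      from′ j k<j j<n = subst (λ w → T′ w ≢ S w → ActiveAt T′ j w)
        (agree-tour tree tree′ agree j k<j (<⇒≤ j<n))
        λ neq → activeAt-agree tree tree′ (λ i j<i → agree i (<-trans k<j j<i)) (agree j k<j j<n)
          (from j k<j j<n λ eq → neq (trans (sym (agree j k<j j<n)) eq))

  activeFrom-exists : ∀ {S} → AlphaInv M S → ∀ d k → d + k ≡ n → Σ EdgeSet λ T → Tree T × ActiveFrom S T k
  activeFrom-exists S-inv zero k refl with spanningTree-exists
  ... | T , tree = T , tree , λ j k≤j j<n → ⊥-elim (<-irrefl refl (<-≤-trans j<n k≤j))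
  activeFrom-exists S-inv (suc d) k eq with activeFrom-exists S-inv d (suc k) (trans (+-suc d k) eq)
  ... | T , tree , from = improve S-inv (subst (k <_) eq (s≤s (m≤n+m k d))) tree from

  -- The invariant at 0 covers both positions of each edge, in particular the last one, on which
  -- `activeAt⇒minimal` relies.
  activeFrom⇒interval : ∀ {S T} → AlphaInv M S → Tree T → ActiveFrom S T 0 → InInterval M T S
  activeFrom⇒interval {S} {T} S-inv tree from = S-inv ,
      (λ h h∈T h∉S → h∈T , minimalIn-⊆ {C = Fund T h} {D = InFundCocycle M T h} (λ _ sp → inj₁ (h∈T , spanning⇒exch sp))
        (minimal λ eq → clash h∈T (trans eq h∉S))) ,
      (λ h h∉T h∈S → h∉T , minimalIn-⊆ {C = Fund T h} {D = InFundCycle M T h} (λ _ sp → inj₂ (h∉T , spanning⇒exch sp))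
        (minimal λ eq → clash (trans eq h∈S) h∉T))
    where
      minimal : ∀ {h} → T h ≢ S h → MinimalIn M T (Fund T h) h
      minimal T≢S = activeAt⇒minimal tree λ k k<n hk → activeAt-edge (inv tree) (edge-sym hk)
        (from k z≤n k<n λ eq → T≢S (trans (sym (inv-edge (inv tree) hk)) (trans eq (inv-edge S-inv hk))))

theorem13 : (M : RootedMap) → (S : Fin (RootedMap.n M) → Bool) → AlphaInv M S →
    (Σ (Fin (RootedMap.n M) → Bool) λ T → SpanningTree M T × InInterval M T S)
    × (∀ T T′ → SpanningTree M T → SpanningTree M T′ →
    InInterval M T S → InInterval M T′ S → ∀ h → T h ≡ T′ h)
theorem13 M S S-inv with activeFrom-exists M S-inv (RootedMap.n M) 0 (+-identityʳ _)
... | T , tree , from =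
  (T , fromTree M tree , activeFrom⇒interval M S-inv tree from) ,
  λ T T′ sp sp′ → interval-unique M (toTree M sp) (toTree M sp′)
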